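{- (i) For every $n\ge 1$, the chain triangular cactus $T_n$ of length $n$ satisfies $s(T_n)=\lfloor (n-2)/2\rfloor+2$. (ii) For every $n\ge 1$, a chain square cactus $O_n$ of length $n$ satisfies $s(O_n)=n+1$.
   Context: The saturation number $s(G)$ is the minimum cardinality of a maximal matching (a set of pairwise vertex-disjoint edges not properly contained in another such set) of $G$. A cactus is a connected graph in which no edge lies in more than one cycle. A triangular cactus is a cactus all of whose blocks are triangles; a chain triangular cactus of length $n$ is a triangular cactus with $n$ triangles in which each triangle has at most two cut-vertices and each cut-vertex is shared by exactly two triangles (equivalently, triangles $B_1,\dots,B_n$ where $B_i$ and $B_{i+1}$ share exactly one vertex and no other pairs share vertices); it has $2n+1$ vertices and $3n$ edges. A chain square cactus $O_n$ of length $n$ is defined in the same way with every triangle replaced by a $4$-cycle $C_4$ (consecutive $4$-cycles sharing exactly one vertex, each cut-vertex shared by exactly two blocks). -}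

module Defs where

open import Data.Nat using (ℕ; suc; _≤_)
open import Data.Fin using (Fin; toℕ)
open import Data.Fin.Subset using (Subset; _∈_; _⊆_; _-_; ⊤; Nonempty)
import Data.Fin as Fin
open import Data.List using (List; length)
open import Data.List.Relation.Unary.All using (All)
open import Data.List.Relation.Unary.AllPairs using (AllPairs)
import Data.List.Relation.Binary.Subset.Propositional as List
open import Data.Product using (Σ-syntax; ∃-syntax; _×_; _,_)
open import Data.Sum using (_⊎_)
open import Function using (_⇔_)
open import Function.Definitions using (Injective)
open import Level using (0ℓ)
open import Relation.Binary using (Rel; Decidable; Symmetric; Irreflexive)
open import Relation.Binary.Construct.Closure.ReflexiveTransitive using (Star)
open import Relation.Binary.PropositionalEquality using (_≡_; _≢_)
open import Relation.Nullary using (¬_)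

record Graph (v : ℕ) : Set₁ where
  field
    Adj    : Rel (Fin v) 0ℓ
    adj?   : Decidable Adj
    sym    : Symmetric Adj
    irrefl : Irreflexive _≡_ Adj

-- Next i j : j is the successor of i in the cyclic order on Fin m.
Next : {m : ℕ} → Fin m → Fin m → Set
Next {m} i j = (toℕ j ≡ suc (toℕ i)) ⊎ (suc (toℕ i) ≡ m × toℕ j ≡ 0)

module _ {v : ℕ} (G : Graph v) where
  open Graph G

  -- The edge {a , b} is represented by the pair with a < b.
  IsEdge : Fin v × Fin v → Set
  IsEdge (a , b) = (a Fin.< b) × Adj a b

  VertexDisjoint : Rel (Fin v × Fin v) 0ℓ
  VertexDisjoint (a , b) (c , d) = (a ≢ c) × (a ≢ d) × (b ≢ c) × (b ≢ d)

  -- Pairwise disjointness excludes repetitions, so the length of the list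
  -- is the cardinality of the matching.
  IsMatching : List (Fin v × Fin v) → Set
  IsMatching M = All IsEdge M × AllPairs VertexDisjoint M

  IsMaximalMatching : List (Fin v × Fin v) → Set
  IsMaximalMatching M =
    IsMatching M × (∀ M′ → IsMatching M′ → M List.⊆ M′ → M′ List.⊆ M)

  IsSaturationNumber : ℕ → Set
  IsSaturationNumber s =
    (∃[ M ] IsMaximalMatching M × length M ≡ s) ×
    (∀ M → IsMaximalMatching M → s ≤ length M)

  -- Below, a vertex set S stands for the induced subgraph G[S]; blocks are
  -- always induced subgraphs, so vertex sets suffice to describe them.

  AdjIn : Subset v → Rel (Fin v) 0ℓ
  AdjIn S x y = x ∈ S × y ∈ S × Adj x y

  -- By convention the empty graph counts as connected, so that the vertex
  -- of a one-vertex graph is not a cut-vertex.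
  ConnectedIn : Subset v → Set
  ConnectedIn S = ∀ x y → x ∈ S → y ∈ S → Star (AdjIn S) x y

  CutVertexIn : Subset v → Fin v → Set
  CutVertexIn S x = x ∈ S × ¬ ConnectedIn (S - x)

  Connected : Set
  Connected = ConnectedIn ⊤

  CutVertex : Fin v → Set
  CutVertex = CutVertexIn ⊤

  Nonseparable : Subset v → Set
  Nonseparable S = Nonempty S × ConnectedIn S × (∀ x → ¬ CutVertexIn S x)

  IsBlock : Subset v → Set
  IsBlock S = Nonseparable S × (∀ T → Nonseparable T → S ⊆ T → T ⊆ S)

  record Cycle : Set where
    field
      len      : ℕ
      len≥3    : 3 ≤ len
      at       : Fin len → Fin v
      distinct : Injective _≡_ _≡_ at
      adjacent : ∀ i j → Next i j → Adj (at i) (at j)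

  OnCycle : Cycle → Fin v → Fin v → Set
  OnCycle C x y = ∃[ i ] ∃[ j ] (Next i j ⊎ Next j i) × at i ≡ x × at j ≡ y
    where open Cycle C

  -- Cycles are compared as subgraphs, i.e. by their edge sets.
  SameCycle : Cycle → Cycle → Set
  SameCycle C D = ∀ x y → OnCycle C x y ⇔ OnCycle D x y

  IsCactus : Set
  IsCactus =
    Connected ×
    (∀ C D x y → OnCycle C x y → OnCycle D x y → SameCycle C D)

  -- G[S] is isomorphic to the cycle graph C_k.
  InducesCycle : ℕ → Subset v → Set
  InducesCycle k S =
    Σ[ c ∈ (Fin k → Fin v) ]
      Injective _≡_ _≡_ c ×
      (∀ x → x ∈ S ⇔ (∃[ i ] c i ≡ x)) ×
      (∀ i j → Adj (c i) (c j) ⇔ (Next i j ⊎ Next j i))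

  -- Chain cactus of length n all of whose blocks are k-cycles.  The
  -- enumeration B only says that there are n blocks; its order is arbitrary.
  record IsChainCactus (k n : ℕ) : Set where
    field
      cactus          : IsCactus
      block-cycle     : ∀ S → IsBlock S → InducesCycle k S
      B               : Fin n → Subset v
      B-block         : ∀ i → IsBlock (B i)
      B-injective     : Injective _≡_ _≡_ B
      B-complete      : ∀ S → IsBlock S → ∃[ i ] B i ≡ S
      -- at most two cut-vertices: among any three, two coincide
      ≤2-cut-vertices : ∀ i x y z → x ∈ B i → y ∈ B i → z ∈ B i →
                        CutVertex x → CutVertex y → CutVertex z →
                        (x ≡ y) ⊎ (x ≡ z) ⊎ (y ≡ z)
      in-two-blocks   : ∀ x → CutVertex x →
                        ∃[ i ] ∃[ j ] i ≢ j × (∀ l → x ∈ B l ⇔ (l ≡ i ⊎ l ≡ j))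

  IsChainTriangularCactus : ℕ → Set
  IsChainTriangularCactus = IsChainCactus 3

  IsChainSquareCactus : ℕ → Set
  IsChainSquareCactus = IsChainCactus 4

{-# OPTIONS --safe #-}
-- A matching is maximal iff its vertices meet every edge.  Ordering the blocks
-- along the chain, let a branch be a final segment of m blocks, hanging from a
-- vertex c of its first block.
--
-- Lower bound: each edge lies in one block.  Give an edge weight w = 2 for
-- triangles and w = 1 for squares; in each block, the weight of its matching
-- edges plus the number of its vertices matched by edges of other blocks is at
-- least 2.  A cut vertex is matched at most once, so by induction a branch
-- carries weight at least m + 1, reduced by one if c is matched from outside.
-- Hence w · |M| ≥ n + 1.
--
-- Upper bound: by induction, every branch has one matching that uses c and one
-- that avoids c (and relies on c being matched outside), each meeting all edges
-- of the branch, with m + 1 and m edges for squares and ⌊(m + 2)/2⌋ and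
-- ⌊(m + 1)/2⌋ edges for triangles.
--
-- The ordering comes from the cactus condition: a vertex shared by two blocks
-- is a cut vertex separating them, so moving on through it never returns.
module Submission where

open import Defs
open import Data.Bool using (Bool; true; false; not)
open import Data.Fin using (Fin; zero; suc; toℕ; fromℕ<)
open import Data.Fin.Properties using (_≟_; all?; any?; <-cmp; <⇒≢; injective⇒≤; toℕ<n; toℕ-fromℕ<)
open import Data.Fin.Subset using (Subset; _∈_; _∉_; _⊆_; _⊂_; _⊃_; _∪_; ⊤; ⁅_⁆)
open import Data.Fin.Subset.Induction using (Acc; acc; ⊂-wellFounded; ⊃-wellFounded)
open import Data.Fin.Subset.Properties using (_∈?_; ∈⊤; x∈⁅x⁆; x∈⁅y⁆⇒x≡y; x∈p∪q⁻; x∈p∪q⁺; p─q⊆p; x∈p∧x≢y⇒x∈p-y; x∈p⇒p-x⊂p; ⊆-antisym)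
open import Data.List using (List; []; _∷_; [_]; _++_; filter; length; lookup; map)
open import Data.List.Properties using (length-++; length-filter; length-map)
open import Data.List.Membership.DecPropositional using () renaming (_∈?_ to ∈ˡ-dec)
open import Data.List.Membership.Propositional using (find; lose) renaming (_∈_ to _∈ˡ_)
open import Data.List.Membership.Propositional.Properties using (∈-filter⁺; ∈-lookup)
open import Data.List.Relation.Unary.All as All using (All; []; _∷_)
import Data.List.Relation.Unary.All.Properties as All
open import Data.List.Relation.Unary.AllPairs as AllPairs using (AllPairs; []; _∷_; allPairs?)
import Data.List.Relation.Unary.AllPairs.Properties as AllPairs
open import Data.List.Relation.Unary.Any as Any using (Any; here; there; index)
import Data.List.Relation.Unary.Any.Properties as Any
open import Data.List.Relation.Unary.Unique.Propositional using (Unique)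
open import Data.Nat using (ℕ; zero; suc; _≤_; _≥_; z≤n; s≤s; ⌊_/2⌋; ⌈_/2⌉; _/_)
import Data.Nat.DivMod as ℕ
import Data.Nat.Properties as ℕ
open import Data.Nat.Solver using (module +-*-Solver)
open import Data.Product using (∃-syntax; _×_; _,_; proj₁; proj₂)
open import Data.Sum using (_⊎_; inj₁; inj₂; [_,_]′; swap)
import Data.Vec as Vec
open import Function using (_∘_; id; Equivalence; mk⇔)
open import Function.Definitions using (Injective)
open import Relation.Binary using (tri<; tri≈; tri>)
open import Relation.Binary.Construct.Closure.ReflexiveTransitive using (Star; ε; _◅_; _◅◅_; reverse) renaming (map to mapStar)
open import Relation.Binary.PropositionalEquality using (_≡_; _≢_; refl; sym; trans; cong; cong₂; subst; subst₂; ≢-sym)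
open import Relation.Nullary using (¬_; Dec; yes; no; contradiction; ¬?; _×-dec_; _⊎-dec_; _→-dec_)
open import Relation.Nullary.Decidable using (decidable-stable; toWitness)
open import Relation.Unary using (Decidable)

open Equivalence using (to; from)

-- Ordering the blocks of a chain cactus

module ChainStructure where
  open Data.Fin.Subset using (_-_)

  lookup-injective : ∀ {A : Set} {xs : List A} → Unique xs → Injective _≡_ _≡_ (lookup xs)
  lookup-injective (_ ∷ _)    {zero}  {zero}  _  = refl
  lookup-injective {xs = _ ∷ xs} (x∉ ∷ _)   {zero}  {suc j} eq = contradiction eq (All.lookup x∉ (∈-lookup {xs = xs} j))
  lookup-injective {xs = _ ∷ xs} (x∉ ∷ _)   {suc i} {zero}  eq = contradiction (sym eq) (All.lookup x∉ (∈-lookup {xs = xs} i))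
  lookup-injective (_ ∷ xs!)  {suc i} {suc j} eq = cong suc (lookup-injective xs! eq)

  unique-complete⇒length : ∀ {n} {xs : List (Fin n)} → Unique xs → (∀ i → i ∈ˡ xs) → length xs ≡ n
  unique-complete⇒length {xs = xs} xs! complete = ℕ.≤-antisym
    (injective⇒≤ (lookup-injective xs!))
    (injective⇒≤ {f = λ i → index (complete i)} (λ {i} {j} eq → trans (Any.lookup-index (complete i))
      (trans (cong (lookup xs) eq) (sym (Any.lookup-index (complete j))))))

  x∉p-x : ∀ {v} (p : Subset v) x → x ∉ p - x
  x∉p-x (_ Vec.∷ p) (suc x) (Vec.there x∈) = x∉p-x p x x∈

  x∈p-y⇒x≢y : ∀ {v} {p : Subset v} {x y} → x ∈ p - y → x ≢ y
  x∈p-y⇒x≢y {p = p} {x} x∈ refl = x∉p-x p x x∈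

  next : ∀ {m} (i : Fin m) → ∃[ j ] Next i j
  next {suc m} i with suc (toℕ i) ℕ.<? suc m
  ... | yes lt = fromℕ< lt , inj₁ (toℕ-fromℕ< lt)
  ... | no ≮ = zero , inj₂ (ℕ.≤-antisym (toℕ<n i) (ℕ.≮⇒≥ ≮) , refl)

  module _ {v : ℕ} (G : Graph v) where
    open Graph G using (Adj; irrefl) renaming (sym to adj-sym)

    -- Walks, simple paths and cycles

    data Path : Fin v → Fin v → List (Fin v) → Set where
      stop : ∀ z → Path z z [ z ]
      step : ∀ {x y z ps} → Adj x y → Path y z ps → Path x z (x ∷ ps)

    path-suffix : ∀ {x y z ps} {P : Fin v → Set} → Path y z ps → Unique ps → All P ps → x ∈ˡ ps →
                  ∃[ qs ] Path x z qs × Unique qs × All P qs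
    path-suffix p@(stop _)   u a (here refl) = _ , p , u , a
    path-suffix p@(step _ _) u a (here refl) = _ , p , u , a
    path-suffix (step _ p) (_ ∷ u) (_ ∷ a) (there x∈) = path-suffix p u a x∈

    AdjAvoiding : Fin v → Fin v → Fin v → Set
    AdjAvoiding c = AdjIn G (⊤ - c)

    _∖_↝_ : Fin v → Fin v → Fin v → Set
    _∖_↝_ x c y = Star (AdjAvoiding c) x y

    avoiding : ∀ {c x y} → x ≢ c → y ≢ c → Adj x y → AdjAvoiding c x y
    avoiding x≢c y≢c xy = x∈p∧x≢y⇒x∈p-y ∈⊤ x≢c , x∈p∧x≢y⇒x∈p-y ∈⊤ y≢c , xy

    ↝-sym : ∀ {c x y} → x ∖ c ↝ y → y ∖ c ↝ x
    ↝-sym = reverse (λ (x∈ , y∈ , xy) → y∈ , x∈ , adj-sym xy)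

    ↝-avoids : ∀ {c x y} → x ≢ c → x ∖ c ↝ y → y ≢ c
    ↝-avoids x≢c ε = x≢c
    ↝-avoids _ ((_ , y∈ , _) ◅ w) = ↝-avoids (x∈p-y⇒x≢y y∈) w

    -- Loop erasure: if `y` already occurs on the simple path found for the rest of the walk, the
    -- suffix from `y` replaces it; otherwise `y` goes in front.
    ↝⇒path : ∀ {c y z} → y ≢ c → y ∖ c ↝ z →
             ∃[ ps ] Path y z ps × Unique ps × All (c ≢_) ps
    ↝⇒path y≢c ε = _ , stop _ , [] ∷ [] , ≢-sym y≢c ∷ []
    ↝⇒path {y = y} y≢c ((_ , y′∈ , yy′) ◅ w) with ↝⇒path (x∈p-y⇒x≢y y′∈) w
    ... | ps , p , u , a with ∈ˡ-dec _≟_ y ps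
    ... | yes y∈ = path-suffix p u a y∈
    ... | no y∉ = _ , step yy′ p , All.tabulate (λ z∈ eq → y∉ (subst (_∈ˡ ps) (sym eq) z∈)) ∷ u , ≢-sym y≢c ∷ a

    path-adjacent : ∀ {x z ps} → Path x z ps → ∀ i j → toℕ j ≡ suc (toℕ i) → Adj (lookup ps i) (lookup ps j)
    path-adjacent (stop _) zero zero ()
    path-adjacent (step xy (stop _))   zero (suc zero) _ = xy
    path-adjacent (step xy (step _ _)) zero (suc zero) _ = xy
    path-adjacent (step _ p) (suc i) (suc j) eq = path-adjacent p i j (ℕ.suc-injective eq)

    path-first : ∀ {x z ps} → Path x z ps → ∀ j → toℕ j ≡ 0 → lookup ps j ≡ x
    path-first (stop _)   zero _ = refl
    path-first (step _ _) zero _ = refl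

    path-last : ∀ {x z ps} → Path x z ps → ∀ i → suc (toℕ i) ≡ length ps → lookup ps i ≡ z
    path-last (stop _) zero _ = refl
    path-last (step _ (stop _)) zero ()
    path-last (step _ (step _ _)) zero ()
    path-last (step _ p) (suc i) eq = path-last p i (ℕ.suc-injective eq)

    path-end : ∀ {x z ps} → Path x z ps → ∃[ i ] suc (toℕ {length ps} i) ≡ length ps
    path-end (stop _)   = zero , refl
    path-end (step _ p) with path-end p
    ... | i , eq = suc i , cong suc eq

    path⇒cycle : ∀ {x z ps} → Path x z ps → Unique ps → 3 ≤ length ps → Adj z x → Cycle G
    path⇒cycle {ps = ps} p u 3≤ zx = record
      { len = length ps ; len≥3 = 3≤ ; at = lookup ps ; distinct = lookup-injective u
      ; adjacent = λ where
          i j (inj₁ eq) → path-adjacent p i j eq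
          i j (inj₂ (eq , eq′)) → subst₂ Adj (sym (path-last p i eq)) (sym (path-first p j eq′)) zx }

    path-start : ∀ {x z ps} → Path x z ps → ∃[ i ] toℕ {length ps} i ≡ 0
    path-start (stop _)   = zero , refl
    path-start (step _ _) = zero , refl

    path-length : ∀ {x z ps} → x ≢ z → Path x z ps → 2 ≤ length ps
    path-length x≢x (stop _)              = contradiction refl x≢x
    path-length _   (step _ (stop _))     = s≤s (s≤s z≤n)
    path-length _   (step _ (step _ _))   = s≤s (s≤s z≤n)

    -- A simple path from `y` to `z` off `x` closes up through `x`. As `y` and `z` differ, it has at
    -- least two vertices, so the cycle has at least three.
    cycle-through : ∀ {x y z} → Adj x y → Adj x z → y ≢ z → y ∖ x ↝ z →
                    ∃[ C ] OnCycle G C x y × OnCycle G C x z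
    cycle-through xy xz y≢z w =
      let ps , p , u , a = ↝⇒path (λ y≡x → irrefl (sym y≡x) xy) w
          first , first≡0 = path-start p
          last , last≡ = path-end p
      in path⇒cycle (step xy p) (a ∷ u) (s≤s (path-length y≢z p)) (adj-sym xz)
       , (zero , suc first , inj₁ (inj₁ (cong suc first≡0)) , refl , path-first p first first≡0)
       , (zero , suc last , inj₂ (inj₂ (cong suc last≡ , refl)) , refl , path-last p last last≡)

    -- Nonseparable sets and their extension to blocks

    pair-connected : ∀ {a b} → Adj a b → ∀ {S} → S ⊆ ⁅ a ⁆ ∪ ⁅ b ⁆ → ConnectedIn G S
    pair-connected {a} {b} ab {S} S⊆ x y x∈ y∈ with x∈p∪q⁻ ⁅ a ⁆ ⁅ b ⁆ (S⊆ x∈) | x∈p∪q⁻ ⁅ a ⁆ ⁅ b ⁆ (S⊆ y∈)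
    ... | inj₁ p | inj₁ q rewrite x∈⁅y⁆⇒x≡y a p | x∈⁅y⁆⇒x≡y a q = ε
    ... | inj₁ p | inj₂ q rewrite x∈⁅y⁆⇒x≡y a p | x∈⁅y⁆⇒x≡y b q = (x∈ , y∈ , ab) ◅ ε
    ... | inj₂ p | inj₁ q rewrite x∈⁅y⁆⇒x≡y b p | x∈⁅y⁆⇒x≡y a q = (x∈ , y∈ , adj-sym ab) ◅ ε
    ... | inj₂ p | inj₂ q rewrite x∈⁅y⁆⇒x≡y b p | x∈⁅y⁆⇒x≡y b q = ε

    -- What remains after deleting a vertex is again contained in the pair, so `pair-connected` also
    -- excludes cut vertices.
    edge-nonseparable : ∀ {a b} → Adj a b → Nonseparable G (⁅ a ⁆ ∪ ⁅ b ⁆)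
    edge-nonseparable {a} {b} ab =
      (a , x∈p∪q⁺ (inj₁ (x∈⁅x⁆ a))) ,
      pair-connected ab (λ x∈ → x∈) ,
      λ x (_ , ¬conn) → ¬conn (pair-connected ab (p─q⊆p _ _))

    -- Subsets of a finite set cannot grow forever, so enlarging `S` ends in a maximal nonseparable
    -- set. Nonseparability is not decided here, hence the double negation.
    ¬¬-extends-to-block : ∀ {S} → Nonseparable G S → ¬ ¬ (∃[ T ] IsBlock G T × S ⊆ T)
    ¬¬-extends-to-block {S} = go S (⊃-wellFounded S)
      where
      go : ∀ S → Acc _⊃_ S → Nonseparable G S → ¬ ¬ (∃[ T ] IsBlock G T × S ⊆ T)
      go S (acc rec) nonsep ¬∃ = ¬∃ (S , (nonsep , maximal) , λ x∈ → x∈)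
        where
        maximal : ∀ T → Nonseparable G T → S ⊆ T → T ⊆ S
        maximal T nonsepT S⊆T {x} x∈T = decidable-stable (x ∈? S) λ x∉S →
          go T (rec (S⊆T , x , x∈T , x∉S)) nonsepT
            λ (U , block , T⊆U) → ¬∃ (U , block , λ y∈ → T⊆U (S⊆T y∈))

    -- Induced cycles

    module _ {k : ℕ} (3≤k : 3 ≤ k) {S : Subset v} (S-cycle : InducesCycle G k S) where
      private
        f = proj₁ S-cycle
        f-injective = proj₁ (proj₂ S-cycle)
        S⇔ = proj₁ (proj₂ (proj₂ S-cycle))
        adj⇔ = proj₂ (proj₂ (proj₂ S-cycle))

      inducedCycle : Cycle G
      inducedCycle = record
        { len = k ; len≥3 = 3≤k ; at = f ; distinct = f-injective
        ; adjacent = λ i j ij → from (adj⇔ i j) (inj₁ ij) }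

      onCycle⇒∈ : ∀ {x y} → OnCycle G inducedCycle x y → x ∈ S
      onCycle⇒∈ (i , _ , _ , fi≡x , _) = from (S⇔ _) (i , fi≡x)

      ∈⇒onCycle : ∀ {x} → x ∈ S → ∃[ y ] Adj x y × OnCycle G inducedCycle x y
      ∈⇒onCycle x∈ with to (S⇔ _) x∈
      ... | i , refl with next i
      ... | j , ij = f j , from (adj⇔ i j) (inj₁ ij) , i , j , inj₁ ij , refl , refl

      another-vertex : ∀ x → ∃[ y ] y ∈ S × y ≢ x
      another-vertex x with f first ≟ x
        where first = fromℕ< (ℕ.≤-trans (s≤s z≤n) 3≤k)
      ... | no ≢x = _ , from (S⇔ _) (_ , refl) , ≢x
      ... | yes refl with next _
      ... | j , ij = f j , from (S⇔ _) (j , refl) ,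
                     λ eq → irrefl (sym eq) (from (adj⇔ _ j) (inj₁ ij))

    -- Every vertex of an induced cycle is an end of one of its edges, so the edge set determines
    -- the vertex set.
    sameCycle⇒⊆ : ∀ {k} 3≤k {S T} (S-cycle : InducesCycle G k S) (T-cycle : InducesCycle G k T) →
                  SameCycle G (inducedCycle 3≤k S-cycle) (inducedCycle 3≤k T-cycle) → S ⊆ T
    sameCycle⇒⊆ 3≤k S-cycle T-cycle same x∈ =
      let y , _ , on = ∈⇒onCycle 3≤k S-cycle x∈
      in onCycle⇒∈ 3≤k T-cycle (to (same _ y) on)

    -- Blocks and cut vertices in a chain cactus

    module ChainCactus {k n : ℕ} (3≤k : 3 ≤ k) (chain : IsChainCactus G k n) where
      open IsChainCactus chain

      block-induces : ∀ j → InducesCycle G k (B j)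
      block-induces j = block-cycle (B j) (B-block j)

      -- Membership in one of finitely many blocks is decidable, which removes the double negation
      -- of `¬¬-extends-to-block`.
      edge-in-block : ∀ {a b} → Adj a b → ∃[ l ] a ∈ B l × b ∈ B l
      edge-in-block {a} {b} ab =
        decidable-stable (any? (λ l → (a ∈? B l) ×-dec (b ∈? B l))) λ ¬∃ →
          ¬¬-extends-to-block (edge-nonseparable ab) λ (T , block , ab⊆T) →
            let l , Bl≡T = B-complete T block
                ab⊆Bl = λ {x} x∈ → subst (x ∈_) (sym Bl≡T) (ab⊆T {x} x∈)
            in ¬∃ (l , ab⊆Bl (x∈p∪q⁺ (inj₁ (x∈⁅x⁆ a))) , ab⊆Bl (x∈p∪q⁺ (inj₂ (x∈⁅x⁆ b))))

      -- If the shared vertex x did not cut, an edge of B i and an edge of B j at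
      -- x would lie on a common cycle, and B i and B j would both be that cycle.
      shared⇒cut : ∀ {x i j} → i ≢ j → x ∈ B i → x ∈ B j → CutVertex G x
      shared⇒cut {x} {i} {j} i≢j x∈i x∈j = ∈⊤ , λ conn →
        let Ci = inducedCycle 3≤k (block-induces i)
            Cj = inducedCycle 3≤k (block-induces j)
            y , xy , y-on = ∈⇒onCycle 3≤k (block-induces i) x∈i
            z , xz , z-on = ∈⇒onCycle 3≤k (block-induces j) x∈j
            same : SameCycle G Ci Cj
            same = same-cycle Ci Cj conn xy xz y-on z-on
        in i≢j (B-injective (⊆-antisym
             (sameCycle⇒⊆ 3≤k (block-induces i) (block-induces j) same)
             (sameCycle⇒⊆ 3≤k (block-induces j) (block-induces i)
               (λ a b → mk⇔ (from (same a b)) (to (same a b))))))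
        where
        same-cycle : ∀ C D {y z} → ConnectedIn G (⊤ - x) → Adj x y → Adj x z →
                     OnCycle G C x y → OnCycle G D x z → SameCycle G C D
        same-cycle C D {y} {z} conn xy xz y-on z-on with y ≟ z
        ... | yes refl = proj₂ cactus C D x y y-on z-on
        ... | no y≢z =
          let avoid = λ {w} (xw : Adj x w) → x∈p∧x≢y⇒x∈p-y ∈⊤ (λ w≡x → irrefl (sym w≡x) xw)
              E , y-onE , z-onE = cycle-through xy xz y≢z (conn y z (avoid xy) (avoid xz))
              CE = proj₂ cactus C E x y y-on y-onE
              ED = proj₂ cactus E D x z z-onE z-on
          in λ a b → mk⇔ (to (ED a b) ∘ to (CE a b)) (from (CE a b) ∘ from (ED a b))

      cut-blocks : ∀ {c j j′} → j ≢ j′ → c ∈ B j → c ∈ B j′ → ∀ l → c ∈ B l → l ≡ j ⊎ l ≡ j′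
      cut-blocks {c} {j} {j′} j≢j′ c∈j c∈j′ l c∈l with in-two-blocks c (shared⇒cut j≢j′ c∈j c∈j′)
      ... | a , b , _ , only with to (only j) c∈j | to (only j′) c∈j′ | to (only l) c∈l
      ... | inj₁ refl | inj₁ refl | _ = contradiction refl j≢j′
      ... | inj₂ refl | inj₂ refl | _ = contradiction refl j≢j′
      ... | inj₁ refl | inj₂ refl | r = r
      ... | inj₂ refl | inj₁ refl | inj₁ r = inj₂ r
      ... | inj₂ refl | inj₁ refl | inj₂ r = inj₁ r

      LinkedAvoiding : Fin v → Fin n → Set
      LinkedAvoiding c j = ∀ {x y} → x ∈ B j → y ∈ B j → x ≢ c → y ≢ c → x ∖ c ↝ y

      -- If `c` lies in the block, it does not cut the block; otherwise the block itself avoids `c`.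
      -- Having no cut vertex only refutes disconnection, hence the double negation.
      ¬¬-block-linked : ∀ c j → ¬ ¬ LinkedAvoiding c j
      ¬¬-block-linked c j ¬linked with c ∈? B j | proj₁ (B-block j)
      ... | yes c∈ | _ , _ , ¬cut = ¬cut c (c∈ , λ conn → ¬linked λ x∈ y∈ x≢c y≢c →
        mapStar (λ (a∈ , b∈ , ab) → avoiding (x∈p-y⇒x≢y a∈) (x∈p-y⇒x≢y b∈) ab)
          (conn _ _ (x∈p∧x≢y⇒x∈p-y x∈ x≢c) (x∈p∧x≢y⇒x∈p-y y∈ y≢c)))
      ... | no c∉ | _ , conn , _ = ¬linked λ x∈ y∈ _ _ →
        mapStar (λ (a∈ , b∈ , ab) → avoiding (λ { refl → c∉ a∈ }) (λ { refl → c∉ b∈ }) ab) (conn _ _ x∈ y∈)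

      -- Stop a walk from `x` to `c` just before its first visit to `c`: the edge that enters `c`
      -- lies in a block through `c`.
      reaches-block : ∀ {c x} → x ≢ c → ∃[ l ] ∃[ z ] c ∈ B l × z ∈ B l × z ≢ c × x ∖ c ↝ z
      reaches-block {c} {x} x≢c = go x≢c (proj₁ cactus x c ∈⊤ ∈⊤)
        where
        go : ∀ {x} → x ≢ c → Star (AdjIn G ⊤) x c → ∃[ l ] ∃[ z ] c ∈ B l × z ∈ B l × z ≢ c × x ∖ c ↝ z
        go x≢c ε = contradiction refl x≢c
        go {x} x≢c (_◅_ {j = y} (_ , _ , xy) w) with y ≟ c
        ... | yes refl = let l , x∈ , c∈ = edge-in-block xy in l , x , c∈ , x∈ , x≢c , ε
        ... | no y≢c =
          let l , z , c∈ , z∈ , z≢c , w′ = go y≢c w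
          in l , z , c∈ , z∈ , z≢c , avoiding x≢c y≢c xy ◅ w′

      -- Every vertex other than `c` reaches, without `c`, a block through `c`, which is `B j` or
      -- `B j′`. A walk from `y` to `y′` off `c` would thus connect all these vertices, and the
      -- shared vertex `c` would not cut.
      separated : ∀ {c j j′ y y′} → j ≢ j′ → c ∈ B j → c ∈ B j′ →
                  y ∈ B j → y ≢ c → y′ ∈ B j′ → y′ ≢ c → ¬ (y ∖ c ↝ y′)
      separated {c} {j} {j′} {y} {y′} j≢j′ c∈j c∈j′ y∈ y≢c y′∈ y′≢c yy′ =
        ¬¬-block-linked c j λ link → ¬¬-block-linked c j′ λ link′ →
        let to-y : ∀ {x} → x ≢ c → x ∖ c ↝ y
            to-y x≢c = case-block link link′ (reaches-block x≢c)
        in proj₂ (shared⇒cut j≢j′ c∈j c∈j′) λ a b a∈ b∈ →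
             to-y (x∈p-y⇒x≢y a∈) ◅◅ ↝-sym (to-y (x∈p-y⇒x≢y b∈))
        where
        case-block : ∀ {x} → LinkedAvoiding c j → LinkedAvoiding c j′ →
                     ∃[ l ] ∃[ z ] c ∈ B l × z ∈ B l × z ≢ c × x ∖ c ↝ z → x ∖ c ↝ y
        case-block link link′ (l , z , c∈l , z∈ , z≢c , w) with cut-blocks j≢j′ c∈j c∈j′ l c∈l
        ... | inj₁ refl = w ◅◅ link z∈ y∈ z≢c y≢c
        ... | inj₂ refl = w ◅◅ link′ z∈ y′∈ z≢c y′≢c ◅◅ ↝-sym yy′

      -- Branch c j js: the blocks js, in order, form a chain hanging from the
      -- vertex c of its first block j.
      data Branch : Fin v → Fin n → List (Fin n) → Set where
        leaf : ∀ {c j} → c ∈ B j →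
               (∀ {l x} → l ≢ j → x ∈ B l → x ∈ B j → x ≡ c) →
               Branch c j [ j ]
        node : ∀ {c j c′ j′ js} → c ∈ B j → c′ ∈ B j → c ≢ c′ →
               (∀ {l x} → l ≢ j → x ∈ B l → x ∈ B j → x ≡ c ⊎ x ≡ c′) →
               (∀ l → c′ ∈ B l → l ≡ j ⊎ l ≡ j′) →
               (∀ {l x} → l ∈ˡ js → x ∈ B l → x ∈ B j → x ≡ c′) →
               Branch c′ j′ js → Branch c j (j ∷ js)

      branch-head : ∀ {c j js} → Branch c j js → j ∈ˡ js
      branch-head (leaf _ _)             = here refl
      branch-head (node _ _ _ _ _ _ _)   = here refl

      -- The far side of a vertex, and the construction of branches

      Reach : Fin v → Fin n → Fin v → Set
      Reach c j y = ∃[ z ] z ∈ B j × z ≢ c × z ∖ c ↝ y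

      reach-avoids : ∀ {c j y} → Reach c j y → y ≢ c
      reach-avoids (_ , _ , z≢c , w) = ↝-avoids z≢c w

      -- The form of the bound on cut vertices that also suits the first block of the chain, where
      -- `c` itself does not cut.
      OneFurtherLink : Fin v → Fin n → Set
      OneFurtherLink c j = ∀ {l l′ x y} → l ≢ j → l′ ≢ j → x ∈ B l → y ∈ B l′ → x ∈ B j → y ∈ B j →
                           x ≢ c → y ≢ c → x ≡ y

      cut⇒oneFurtherLink : ∀ {c j i} → i ≢ j → c ∈ B i → c ∈ B j → OneFurtherLink c j
      cut⇒oneFurtherLink {c} {j} i≢j c∈i c∈j {x = x} {y} l≢j l′≢j x∈l y∈l′ x∈j y∈j x≢c y≢c
        with ≤2-cut-vertices j c x y c∈j x∈j y∈j (shared⇒cut i≢j c∈i c∈j) (shared⇒cut l≢j x∈l x∈j) (shared⇒cut l′≢j y∈l′ y∈j)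
      ... | inj₁ c≡x = contradiction (sym c≡x) x≢c
      ... | inj₂ (inj₁ c≡y) = contradiction (sym c≡y) y≢c
      ... | inj₂ (inj₂ x≡y) = x≡y

      module Step {c j c′ j′} (c∈j : c ∈ B j) (c′∈j : c′ ∈ B j) (c≢c′ : c ≢ c′)
                  (j≢j′ : j ≢ j′) (c′∈j′ : c′ ∈ B j′) where

        -- Since `c′` separates `c` from `B j′`, a walk beyond `c′` never meets `c`. A piece inside
        -- `B j′` joins its start to `c′`, a vertex of `B j`.
        further-reach : ∀ {y} → Reach c′ j′ y → ¬ ¬ Reach c j y
        further-reach (z , z∈ , z≢c′ , w) ¬reach = ¬¬-block-linked c j′ λ link →
          ¬reach (c′ , c′∈j , ≢-sym c≢c′ , link c′∈j′ z∈ (≢-sym c≢c′) (≢c z∈ z≢c′ ε) ◅◅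
                             avoid (λ w → ≢c z∈ z≢c′ w) w)
          where
          ≢c : ∀ {z x} → z ∈ B j′ → z ≢ c′ → z ∖ c′ ↝ x → x ≢ c
          ≢c z∈ z≢c′ w refl = separated j≢j′ c′∈j c′∈j′ c∈j c≢c′ z∈ z≢c′ (↝-sym w)
          avoid : ∀ {x y} → (∀ {u} → x ∖ c′ ↝ u → u ≢ c) → x ∖ c′ ↝ y → x ∖ c ↝ y
          avoid ≢c ε = ε
          avoid ≢c (e@(_ , _ , xu) ◅ w) = avoiding (≢c ε) (≢c (e ◅ ε)) xu ◅ avoid (λ w′ → ≢c (e ◅ w′)) w

        -- A walk off `c` can leave `B j` only at `c′`, into `B j′`; from there it stays beyond `c′`
        -- until it returns to `c′`, which is in `B j` again.
        reach-splits : OneFurtherLink c j → ∀ {y} → Reach c j y → y ∈ B j ⊎ Reach c′ j′ y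
        reach-splits one (z , z∈ , z≢c , w) = go (inj₁ z∈) w
          where
          go : ∀ {x y} → x ∈ B j ⊎ Reach c′ j′ x → x ∖ c ↝ y → y ∈ B j ⊎ Reach c′ j′ y
          go p ε = p
          go {x} (inj₁ x∈) (_◅_ {j = u} (x∈-c , _ , xu) w) with edge-in-block xu
          ... | l , x∈l , u∈l with l ≟ j
          ... | yes refl = go (inj₁ u∈l) w
          ... | no l≢j with one l≢j (≢-sym j≢j′) x∈l c′∈j′ x∈ c′∈j (x∈p-y⇒x≢y x∈-c) (≢-sym c≢c′)
          ... | refl with cut-blocks j≢j′ c′∈j c′∈j′ l x∈l
          ... | inj₁ l≡j = contradiction l≡j l≢j
          ... | inj₂ refl = go (inj₂ (u , u∈l , (λ u≡x → irrefl (sym u≡x) xu) , ε)) w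
          go (inj₂ r@(s , s∈ , s≢c′ , w₀)) (_◅_ {j = u} (_ , _ , xu) w) with u ≟ c′
          ... | yes refl = go (inj₁ c′∈j) w
          ... | no u≢c′ = go (inj₂ (s , s∈ , s≢c′ , w₀ ◅◅ avoiding (reach-avoids r) u≢c′ xu ◅ ε)) w

      -- `complete` makes the final chain exhaust all blocks; `sound` keeps later blocks beyond the
      -- link, so that none of them meets an earlier block elsewhere.
      record Chain (c : Fin v) (j : Fin n) : Set where
        field
          blocks   : List (Fin n)
          branch   : Branch c j blocks
          complete : ∀ {l y} → y ∈ B l → Reach c j y → l ∈ˡ blocks
          sound    : ∀ {l y} → l ∈ˡ blocks → y ∈ B l → y ≢ c → ¬ ¬ Reach c j y

      -- U bounds the part of G that the branch may still use: every step moves on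
      -- to the far side of a cut vertex, which is thereby removed from U.
      build : ∀ U → Acc _⊂_ U → ∀ {c j} → c ∈ B j → OneFurtherLink c j →
              (∀ {y} → Reach c j y → y ∈ U) → Chain c j
      build U (acc rec) {c} {j} c∈j one reach⊆U
        with any? (λ c′ → any? (λ j′ → ¬? (c ≟ c′) ×-dec ¬? (j ≟ j′) ×-dec (c′ ∈? B j) ×-dec (c′ ∈? B j′)))
      ... | no none = record
        { blocks = [ j ] ; branch = leaf c∈j only
        ; complete = λ y∈l r → here (complete y∈l r)
        ; sound = λ { (here refl) y∈ y≢c ¬r → ¬r (_ , y∈ , y≢c , ε) } }
        where
        only : ∀ {l x} → l ≢ j → x ∈ B l → x ∈ B j → x ≡ c
        only {l} {x} l≢j x∈l x∈j = decidable-stable (x ≟ c) λ x≢c →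
          none (x , l , ≢-sym x≢c , ≢-sym l≢j , x∈j , x∈l)
        stay : ∀ {x y} → x ∈ B j → x ∖ c ↝ y → y ∈ B j
        stay x∈ ε = x∈
        stay x∈ ((x∈-c , _ , xu) ◅ w) with edge-in-block xu
        ... | l , x∈l , u∈l with l ≟ j
        ... | yes refl = stay u∈l w
        ... | no l≢j = contradiction (only l≢j x∈l x∈) (x∈p-y⇒x≢y x∈-c)
        complete : ∀ {l y} → y ∈ B l → Reach c j y → l ≡ j
        complete {l} y∈l r@(z , z∈ , z≢c , w) = decidable-stable (l ≟ j) λ l≢j →
          reach-avoids r (only l≢j y∈l (stay z∈ w))
      ... | yes (c′ , j′ , c≢c′ , j≢j′ , c′∈j , c′∈j′) = record
        { blocks = j ∷ blocks
        ; branch = node c∈j c′∈j c≢c′ only (cut-blocks j≢j′ c′∈j c′∈j′) fresh branch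
        ; complete = complete′ ; sound = sound′ }
        where
        open Step c∈j c′∈j c≢c′ j≢j′ c′∈j′
        c′∈U : c′ ∈ U
        c′∈U = reach⊆U (c′ , c′∈j , ≢-sym c≢c′ , ε)
        open Chain (build (U - c′) (rec (x∈p⇒p-x⊂p c′∈U)) c′∈j′ (cut⇒oneFurtherLink j≢j′ c′∈j c′∈j′)
          (λ {y} r → x∈p∧x≢y⇒x∈p-y (decidable-stable (y ∈? U) λ y∉U → further-reach r λ r′ → y∉U (reach⊆U r′))
                             (reach-avoids r)))
        only : ∀ {l x} → l ≢ j → x ∈ B l → x ∈ B j → x ≡ c ⊎ x ≡ c′
        only {x = x} l≢j x∈l x∈j with x ≟ c
        ... | yes x≡c = inj₁ x≡c
        ... | no x≢c = inj₂ (one l≢j (≢-sym j≢j′) x∈l c′∈j′ x∈j c′∈j x≢c (≢-sym c≢c′))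
        -- A later block meeting `B j` off `c′` would have a vertex of `B j` reached from `B j′`
        -- without `c′`.
        fresh : ∀ {l x} → l ∈ˡ blocks → x ∈ B l → x ∈ B j → x ≡ c′
        fresh {l} {x} l∈ x∈l x∈j = decidable-stable (x ≟ c′) λ x≢c′ →
          sound l∈ x∈l x≢c′ λ (z , z∈ , z≢c′ , w) →
            separated j≢j′ c′∈j c′∈j′ x∈j x≢c′ z∈ z≢c′ (↝-sym w)
        complete′ : ∀ {l y} → y ∈ B l → Reach c j y → l ∈ˡ j ∷ blocks
        complete′ {l} y∈l r with reach-splits one r
        ... | inj₂ r′ = there (complete y∈l r′)
        ... | inj₁ y∈j with l ≟ j
        ... | yes l≡j = here l≡j
        ... | no l≢j with only l≢j y∈l y∈j
        ... | inj₁ y≡c = contradiction y≡c (reach-avoids r)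
        ... | inj₂ refl with cut-blocks j≢j′ c′∈j c′∈j′ l y∈l
        ... | inj₁ l≡j = here l≡j
        ... | inj₂ refl = there (branch-head branch)
        sound′ : ∀ {l y} → l ∈ˡ j ∷ blocks → y ∈ B l → y ≢ c → ¬ ¬ Reach c j y
        sound′ (here refl) y∈ y≢c ¬r = ¬r (_ , y∈ , y≢c , ε)
        sound′ {y = y} (there l∈) y∈ y≢c ¬r with y ≟ c′
        ... | yes refl = ¬r (y , c′∈j , y≢c , ε)
        ... | no y≢c′ = sound l∈ y∈ y≢c′ λ r′ → further-reach r′ ¬r

      EndBlock : Fin n → Set
      EndBlock j = ∃[ c ] ∀ {l x} → l ≢ j → x ∈ B l → x ∈ B j → x ≡ c

      branch-end : ∀ {c j js} → Branch c j js → ∃[ i ] EndBlock i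
      branch-end (leaf _ only)              = _ , _ , only
      branch-end (node _ _ _ _ _ _ branch)  = branch-end branch

      -- From a vertex shared with a second block a branch can be built, and its last block
      -- qualifies. A block that shares nothing qualifies vacuously, with any vertex.
      end-block : Fin n → ∃[ i ] EndBlock i
      end-block j with any? (λ c → any? (λ i → ¬? (i ≟ j) ×-dec (c ∈? B i) ×-dec (c ∈? B j)))
      ... | yes (c , i , i≢j , c∈i , c∈j) =
        branch-end (Chain.branch (build ⊤ (⊂-wellFounded ⊤) c∈j (cut⇒oneFurtherLink i≢j c∈i c∈j) (λ _ → ∈⊤)))
      ... | no none = j , proj₁ (proj₁ (proj₁ (B-block j))) ,
        λ {l} {x} l≢j x∈l x∈j → contradiction (x , l , l≢j , x∈l , x∈j) none

      -- Start in an end block at a vertex `c` other than its only possible link `e`. Then `c` is in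
      -- one block only, so it does not cut, every other vertex is on its far side, and `complete`
      -- yields all blocks.
      spanning-branch : Fin n → ∃[ c ] ∃[ j ] ∃[ js ] Branch c j js × (∀ l → l ∈ˡ js)
      spanning-branch j₀ with end-block j₀
      ... | j , e , only with another-vertex 3≤k (block-induces j) e
      ... | c , c∈j , c≢e = c , j , Chain.blocks chain′ , Chain.branch chain′ , all
        where
        chain′ : Chain c j
        chain′ = build ⊤ (⊂-wellFounded ⊤) c∈j
          (λ l≢j l′≢j x∈l y∈l′ x∈j y∈j _ _ → trans (only l≢j x∈l x∈j) (sym (only l′≢j y∈l′ y∈j)))
          (λ _ → ∈⊤)
        only-block : ∀ l → c ∈ B l → l ≡ j
        only-block l c∈l = decidable-stable (l ≟ j) λ l≢j → c≢e (only l≢j c∈l c∈j)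
        not-cut : ¬ CutVertex G c
        not-cut cut with in-two-blocks c cut
        ... | a , b , a≢b , in⇔ =
          a≢b (trans (only-block a (from (in⇔ a) (inj₁ refl))) (sym (only-block b (from (in⇔ b) (inj₂ refl)))))
        all : ∀ l → l ∈ˡ Chain.blocks chain′
        all l with another-vertex 3≤k (block-induces l) c | another-vertex 3≤k (block-induces j) c
        ... | y , y∈ , y≢c | z , z∈ , z≢c = decidable-stable (∈ˡ-dec _≟_ l _) λ l∉ →
          not-cut (∈⊤ , λ conn → l∉ (Chain.complete chain′ y∈
            (z , z∈ , z≢c , conn z y (x∈p∧x≢y⇒x∈p-y ∈⊤ z≢c) (x∈p∧x≢y⇒x∈p-y ∈⊤ y≢c))))

      branch-unique : ∀ {c j js} → Branch c j js → Unique js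
      branch-unique (leaf _ _) = [] ∷ []
      branch-unique (node c∈ c′∈ c≢c′ _ _ fresh branch) =
        All.tabulate (λ { l∈ refl → c≢c′ (fresh l∈ c∈ c∈) }) ∷ branch-unique branch

-- Matchings along the chain

module Saturation where
  open Data.Nat using (_+_; _*_)
  open ChainStructure

  -- A Boolean index lets one construction treat both the matchings that cover a vertex and those
  -- that avoid it.
  Status : Bool → Set → Set
  Status true  A = A
  Status false A = ¬ A

  status? : ∀ t {A : Set} → Dec A → Dec (Status t A)
  status? true  a? = a?
  status? false a? = ¬? a?

  indicator : ∀ {A : Set} → Dec A → ℕ
  indicator (yes _) = 1
  indicator (no _)  = 0

  indicator-mono : ∀ {A A′ : Set} (a? : Dec A) (a′? : Dec A′) → (A → A′) → indicator a? ≤ indicator a′?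
  indicator-mono (no _)  _        _ = z≤n
  indicator-mono (yes _) (yes _)  _ = s≤s z≤n
  indicator-mono (yes a) (no ¬a′) f = contradiction (f a) ¬a′

  indicator-exclusive : ∀ {A A′ : Set} (a? : Dec A) (a′? : Dec A′) → (A → ¬ A′) → indicator a? + indicator a′? ≤ 1
  indicator-exclusive (no _)  (no _)   _ = z≤n
  indicator-exclusive (no _)  (yes _)  _ = s≤s z≤n
  indicator-exclusive (yes _) (no _)   _ = s≤s z≤n
  indicator-exclusive (yes a) (yes a′) f = contradiction a′ (f a)

  indicator-yes : ∀ {A : Set} (a? : Dec A) → A → 1 ≤ indicator a?
  indicator-yes (yes _) _ = s≤s z≤n
  indicator-yes (no ¬a) a = contradiction a ¬a

  indicator-no : ∀ {A : Set} (a? : Dec A) → ¬ A → indicator a? ≡ 0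
  indicator-no (yes a) ¬a = contradiction a ¬a
  indicator-no (no _)  _  = refl

  length-filter-disjoint : ∀ {A : Set} {P Q R : A → Set} (P? : Decidable P) (Q? : Decidable Q) (R? : Decidable R) {xs} →
    All (λ x → P x → ¬ Q x) xs → (∀ {x} → P x → R x) → (∀ {x} → Q x → R x) →
    length (filter P? xs) + length (filter Q? xs) ≤ length (filter R? xs)
  length-filter-disjoint P? Q? R? [] P⊆R Q⊆R = z≤n
  length-filter-disjoint P? Q? R? {x ∷ xs} (disjoint ∷ ds) P⊆R Q⊆R
    with P? x | Q? x | R? x | length-filter-disjoint P? Q? R? ds P⊆R Q⊆R
  ... | yes p | yes q | _ | _ = contradiction q (disjoint p)
  ... | yes p | no _ | yes _ | ih = s≤s ih
  ... | yes p | no _ | no ¬r | _ = contradiction (P⊆R p) ¬r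
  ... | no _ | yes q | yes _ | ih = ℕ.≤-trans (ℕ.≤-reflexive (ℕ.+-suc _ _)) (s≤s ih)
  ... | no _ | yes q | no ¬r | _ = contradiction (Q⊆R q) ¬r
  ... | no _ | no _ | yes _ | ih = ℕ.m≤n⇒m≤1+n ih
  ... | no _ | no _ | no _ | ih = ih

  -- Edges as pairs, and the vertices they cover

  module _ {m : ℕ} where
    _∈ᵉ_ : Fin m → Fin m × Fin m → Set
    x ∈ᵉ (a , b) = x ≡ a ⊎ x ≡ b

    _∈ᵉ?_ : ∀ x e → Dec (x ∈ᵉ e)
    x ∈ᵉ? (a , b) = (x ≟ a) ⊎-dec (x ≟ b)

    -- The formula of `VertexDisjoint` without a graph, so that it also applies to the model cycles
    -- on `Fin k`.
    Disjoint : Fin m × Fin m → Fin m × Fin m → Set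
    Disjoint (a , b) (c , d) = (a ≢ c) × (a ≢ d) × (b ≢ c) × (b ≢ d)

    disjoint? : ∀ e f → Dec (Disjoint e f)
    disjoint? (a , b) (c , d) = ¬? (a ≟ c) ×-dec ¬? (a ≟ d) ×-dec ¬? (b ≟ c) ×-dec ¬? (b ≟ d)

    disjoint⁺ : ∀ {e f} → (∀ {x} → x ∈ᵉ e → ¬ (x ∈ᵉ f)) → Disjoint e f
    disjoint⁺ no-common =
      no-common (inj₁ refl) ∘ inj₁ , no-common (inj₁ refl) ∘ inj₂ ,
      no-common (inj₂ refl) ∘ inj₁ , no-common (inj₂ refl) ∘ inj₂

    disjoint⁻ : ∀ {e f} → Disjoint e f → ∀ {x} → x ∈ᵉ e → ¬ (x ∈ᵉ f)
    disjoint⁻ (ac , ad , bc , bd) (inj₁ refl) (inj₁ eq) = ac eq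
    disjoint⁻ (ac , ad , bc , bd) (inj₁ refl) (inj₂ eq) = ad eq
    disjoint⁻ (ac , ad , bc , bd) (inj₂ refl) (inj₁ eq) = bc eq
    disjoint⁻ (ac , ad , bc , bd) (inj₂ refl) (inj₂ eq) = bd eq

    Covers : List (Fin m × Fin m) → Fin m → Set
    Covers M x = Any (x ∈ᵉ_) M

    covers? : ∀ M x → Dec (Covers M x)
    covers? M x = Any.any? (x ∈ᵉ?_) M

    disjoint-shared : ∀ {M e f x} → AllPairs Disjoint M → e ∈ˡ M → f ∈ˡ M → x ∈ᵉ e → x ∈ᵉ f → e ≡ f
    disjoint-shared _         (here refl) (here refl) _   _   = refl
    disjoint-shared (d ∷ _)   (here refl) (there f∈)  x∈e x∈f = contradiction x∈f (disjoint⁻ (All.lookup d f∈) x∈e)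
    disjoint-shared (d ∷ _)   (there e∈)  (here refl) x∈e x∈f = contradiction x∈e (disjoint⁻ (All.lookup d e∈) x∈f)
    disjoint-shared (_ ∷ ds)  (there e∈)  (there f∈)  x∈e x∈f = disjoint-shared ds e∈ f∈ x∈e x∈f

    -- `IsEdge` asks for the smaller end first. The value at equal ends is arbitrary, as adjacency
    -- is irreflexive.
    orient : Fin m × Fin m → Fin m × Fin m
    orient (a , b) with <-cmp a b
    ... | tri< _ _ _ = a , b
    ... | tri≈ _ _ _ = a , b
    ... | tri> _ _ _ = b , a

    ∈ᵉ-orient⁺ : ∀ {x} e → x ∈ᵉ e → x ∈ᵉ orient e
    ∈ᵉ-orient⁺ (a , b) x∈ with <-cmp a b
    ... | tri< _ _ _ = x∈
    ... | tri≈ _ _ _ = x∈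
    ... | tri> _ _ _ = swap x∈

    ∈ᵉ-orient⁻ : ∀ {x} e → x ∈ᵉ orient e → x ∈ᵉ e
    ∈ᵉ-orient⁻ (a , b) x∈ with <-cmp a b
    ... | tri< _ _ _ = x∈
    ... | tri≈ _ _ _ = x∈
    ... | tri> _ _ _ = swap x∈

  module _ {v : ℕ} (G : Graph v) where
    open Graph G using (Adj; irrefl) renaming (sym to adj-sym)

    orient-isEdge : ∀ {a b} → Adj a b → IsEdge G (orient (a , b))
    orient-isEdge {a} {b} ab with <-cmp a b
    ... | tri< a<b _ _ = a<b , ab
    ... | tri≈ _ a≡b _ = contradiction ab (irrefl a≡b)
    ... | tri> _ _ b<a = b<a , adj-sym ab

    isEdge⇒≢ : ∀ {a b} → IsEdge G (a , b) → a ≢ b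
    isEdge⇒≢ (a<b , _) = <⇒≢ a<b

    -- Maximal matchings are those that meet every edge

    Dominating : List (Fin v × Fin v) → Set
    Dominating M = ∀ {a b} → Adj a b → ∃[ x ] x ∈ᵉ (a , b) × Covers M x

    -- An edge of a larger matching meets some edge of `M`; both belong to the larger matching, so
    -- they coincide.
    dominating⇒maximal : ∀ {M} → IsMatching G M → Dominating M → IsMaximalMatching G M
    dominating⇒maximal {M} matching dominating = matching , maximal
      where
      maximal : ∀ M′ → IsMatching G M′ → (∀ {e} → e ∈ˡ M → e ∈ˡ M′) → ∀ {e} → e ∈ˡ M′ → e ∈ˡ M
      maximal M′ (edges′ , disjoint′) M⊆M′ {e} e∈ =
        let x , x∈e , covered = dominating (proj₂ (All.lookup edges′ e∈))
            f , f∈M , x∈f = find covered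
        in subst (_∈ˡ M) (disjoint-shared disjoint′ (M⊆M′ f∈M) e∈ x∈f x∈e) f∈M

    maximal⇒dominating : ∀ {M} → IsMaximalMatching G M → Dominating M
    maximal⇒dominating {M} ((edges , disjoint) , maximal) {a} {b} ab
      with covers? M a | covers? M b
    ... | yes covered | _ = a , inj₁ refl , covered
    ... | no _ | yes covered = b , inj₂ refl , covered
    -- With both ends uncovered the edge extends `M`, so maximality puts it in `M` already, which
    -- covers `a`.
    ... | no ¬a | no ¬b =
      a , inj₁ refl , lose (maximal (e ∷ M) (orient-isEdge ab ∷ edges , new ∷ disjoint) there (here refl))
                           (∈ᵉ-orient⁺ (a , b) (inj₁ refl))
      where
      e = orient (a , b)
      new : All (Disjoint e) M
      new = All.tabulate λ {f} f∈ → disjoint⁺ λ x∈e x∈f → case-end f∈ x∈f (∈ᵉ-orient⁻ (a , b) x∈e)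
        where
        case-end : ∀ {f x} → f ∈ˡ M → x ∈ᵉ f → ¬ (x ∈ᵉ (a , b))
        case-end f∈ x∈f (inj₁ refl) = ¬a (lose f∈ x∈f)
        case-end f∈ x∈f (inj₂ refl) = ¬b (lose f∈ x∈f)

    -- Contribution of a single block

    EdgeIn : Subset v → Fin v × Fin v → Set
    EdgeIn S (a , b) = a ∈ S × b ∈ S

    edgeIn? : ∀ S e → Dec (EdgeIn S e)
    edgeIn? S (a , b) = (a ∈? S) ×-dec (b ∈? S)

    edgeIn-∈ : ∀ {S e x} → EdgeIn S e → x ∈ᵉ e → x ∈ S
    edgeIn-∈ (a∈ , _) (inj₁ refl) = a∈
    edgeIn-∈ (_ , b∈) (inj₂ refl) = b∈

    -- The block hangs from `c` and is continued at `c′`. Edges at these two vertices are excused,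
    -- since other blocks may cover them; `t` and `s` record what the block covers itself.
    record LocalMatching (S : Subset v) (c c′ : Fin v) (t s : Bool) (size : ℕ) : Set where
      field
        M          : List (Fin v × Fin v)
        matching   : IsMatching G M
        inside     : All (EdgeIn S) M
        covers-c   : Status t (Covers M c)
        covers-c′  : Status s (Covers M c′)
        dominating : ∀ {a b} → a ∈ S → b ∈ S → Adj a b →
                     ∃[ x ] x ∈ᵉ (a , b) × (Covers M x ⊎ x ≡ c ⊎ x ≡ c′)
        size≡      : length M ≡ size

    -- size t m is the number of edges of the matching of a branch of m blocks
    -- hanging from c, where t says whether the matching covers c.
    record Scheme (k : ℕ) : Set where
      field
        size : Bool → ℕ → ℕ
        last : ∀ {S c c′} → InducesCycle G k S → c ∈ S → c′ ∈ S → c ≢ c′ →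
               ∀ t → LocalMatching S c c′ t true (size t 1)
        more : ∀ {S c c′} → InducesCycle G k S → c ∈ S → c′ ∈ S → c ≢ c′ →
               ∀ t m → ∃[ s ] ∃[ p ] LocalMatching S c c′ t s p × p + size (not s) m ≡ size t (suc m)

    -- `E` stands for being matched by an edge of another block, and `L` for the matching edges
    -- inside this one.
    LocalBound : ℕ → ℕ → Set₁
    LocalBound k w =
      ∀ {S c c′} → InducesCycle G k S → c ∈ S → c′ ∈ S → c ≢ c′ →
      ∀ {E : Fin v → Set} (E? : Decidable E) L → All (IsEdge G) L → All (EdgeIn S) L →
      (∀ {x} → x ∈ S → E x → x ≡ c ⊎ x ≡ c′) →
      (∀ {a b} → a ∈ S → b ∈ S → Adj a b → ∃[ x ] x ∈ᵉ (a , b) × (Covers L x ⊎ E x)) →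
      2 ≤ w * length L + (indicator (E? c) + indicator (E? c′))

    module _ {k n : ℕ} (3≤k : 3 ≤ k) (chain : IsChainCactus G k n) where
      open IsChainCactus chain
      open ChainCactus G 3≤k chain

      InBlocks : List (Fin n) → Fin v × Fin v → Set
      InBlocks js e = Any (λ l → EdgeIn (B l) e) js

      inBlocks? : ∀ js e → Dec (InBlocks js e)
      inBlocks? js e = Any.any? (λ l → edgeIn? (B l) e) js

      inBlocks-∈ : ∀ {js e x} → InBlocks js e → x ∈ᵉ e → ∃[ l ] l ∈ˡ js × x ∈ B l
      inBlocks-∈ i x∈ = let l , l∈ , e∈ = find i in l , l∈ , edgeIn-∈ e∈ x∈

      -- Upper bound: gluing block matchings along a branch

      record BranchMatching (c : Fin v) (js : List (Fin n)) (t : Bool) (size : ℕ) : Set where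
        field
          M          : List (Fin v × Fin v)
          matching   : IsMatching G M
          inside     : All (InBlocks js) M
          covers-c   : Status t (Covers M c)
          dominating : ∀ {l a b} → l ∈ˡ js → a ∈ B l → b ∈ B l → Adj a b →
                       ∃[ x ] x ∈ᵉ (a , b) × (Covers M x ⊎ x ≡ c)
          size≡      : length M ≡ size

      local⇒branch : ∀ {c c′ j t p} → LocalMatching (B j) c c′ t true p → BranchMatching c [ j ] t p
      local⇒branch local = record
        { M = M ; matching = matching ; inside = All.map here inside ; covers-c = covers-c
        ; dominating = λ { (here refl) a∈ b∈ ab → let x , x∈ , d = dominating a∈ b∈ ab in x , x∈ , drop d }
        ; size≡ = size≡ }
        where
        open LocalMatching local
        drop : ∀ {x} → Covers M x ⊎ x ≡ _ ⊎ x ≡ _ → Covers M x ⊎ x ≡ _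
        drop (inj₁ covered)     = inj₁ covered
        drop (inj₂ (inj₁ x≡c))  = inj₂ x≡c
        drop (inj₂ (inj₂ refl)) = inj₁ covers-c′

      -- By the statuses `s` and `not s`, exactly one side covers `c′`, the only vertex both sides
      -- can share. So the union is a matching, and edges excused at `c′` are met.
      glue : ∀ {c c′ j js} → c ∈ B j → c ≢ c′ → (∀ {l x} → l ∈ˡ js → x ∈ B l → x ∈ B j → x ≡ c′) →
             ∀ {t s p q} → LocalMatching (B j) c c′ t s p → BranchMatching c′ js (not s) q →
             BranchMatching c (j ∷ js) t (p + q)
      glue {c} {c′} {j} {js} c∈j c≢c′ fresh {t} {s} local rest = record
        { M = L.M ++ R.M
        ; matching = All.++⁺ (proj₁ L.matching) (proj₁ R.matching)
                   , AllPairs.++⁺ (proj₂ L.matching) (proj₂ R.matching)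
                       (All.tabulate λ e∈ → All.tabulate λ f∈ → disjoint⁺ (no-common e∈ f∈))
        ; inside = All.++⁺ (All.map here L.inside) (All.map there R.inside)
        ; covers-c = status-c t L.covers-c
        ; dominating = dominating
        ; size≡ = trans (length-++ L.M) (cong₂ _+_ L.size≡ R.size≡) }
        where
        module L = LocalMatching local
        module R = BranchMatching rest
        exclusive : ∀ s {A A′ : Set} → Status s A → Status (not s) A′ → A → ¬ A′
        exclusive true  _  ¬A′ _ A′ = ¬A′ A′
        exclusive false ¬A _   A _  = ¬A A
        either : ∀ s {A A′ : Set} → Status s A → Status (not s) A′ → A ⊎ A′
        either true  A _  = inj₁ A
        either false _ A′ = inj₂ A′
        no-common : ∀ {e f x} → e ∈ˡ L.M → f ∈ˡ R.M → x ∈ᵉ e → ¬ (x ∈ᵉ f)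
        no-common e∈ f∈ x∈e x∈f with inBlocks-∈ (All.lookup R.inside f∈) x∈f
        ... | l , l∈ , x∈l with fresh l∈ x∈l (edgeIn-∈ (All.lookup L.inside e∈) x∈e)
        ... | refl = exclusive s L.covers-c′ R.covers-c (lose e∈ x∈e) (lose f∈ x∈f)
        ¬covers-c : ¬ Covers R.M c
        ¬covers-c covered =
          let f , f∈ , c∈f = find covered
              l , l∈ , c∈l = inBlocks-∈ (All.lookup R.inside f∈) c∈f
          in c≢c′ (fresh l∈ c∈l c∈j)
        status-c : ∀ t → Status t (Covers L.M c) → Status t (Covers (L.M ++ R.M) c)
        status-c true  covered = Any.++⁺ˡ covered
        status-c false ¬covered = [ ¬covered , ¬covers-c ]′ ∘ Any.++⁻ L.M
        c′-covered : Covers (L.M ++ R.M) c′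
        c′-covered = [ Any.++⁺ˡ , Any.++⁺ʳ L.M ]′ (either s L.covers-c′ R.covers-c)
        dominating : ∀ {l a b} → l ∈ˡ j ∷ js → a ∈ B l → b ∈ B l → Adj a b →
                     ∃[ x ] x ∈ᵉ (a , b) × (Covers (L.M ++ R.M) x ⊎ x ≡ c)
        dominating (here refl) a∈ b∈ ab with L.dominating a∈ b∈ ab
        ... | x , x∈ , inj₁ covered     = x , x∈ , inj₁ (Any.++⁺ˡ covered)
        ... | x , x∈ , inj₂ (inj₁ x≡c)  = x , x∈ , inj₂ x≡c
        ... | x , x∈ , inj₂ (inj₂ refl) = x , x∈ , inj₁ c′-covered
        dominating (there l∈) a∈ b∈ ab with R.dominating l∈ a∈ b∈ ab
        ... | x , x∈ , inj₁ covered = x , x∈ , inj₁ (Any.++⁺ʳ L.M covered)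
        ... | x , x∈ , inj₂ refl    = x , x∈ , inj₁ c′-covered

      branch-matching : (scheme : Scheme k) → ∀ {c j js} → Branch c j js →
                        ∀ t → BranchMatching c js t (Scheme.size scheme t (length js))
      branch-matching scheme {c} {j} (leaf c∈ _) t =
        -- The last block has no second link; any other vertex takes its place, covered by the block
        -- itself.
        let c′ , c′∈ , c′≢c = another-vertex G 3≤k (block-induces j) c
        in local⇒branch (Scheme.last scheme (block-induces j) c∈ c′∈ (≢-sym c′≢c) t)
      branch-matching scheme {c} {j} {js = _ ∷ js} (node c∈ c′∈ c≢c′ _ _ fresh branch) t =
        let s , p , local , size≡ = Scheme.more scheme (block-induces j) c∈ c′∈ c≢c′ t (length js)
        in subst (BranchMatching c (j ∷ js) t) size≡
             (glue c∈ c≢c′ fresh local (branch-matching scheme branch (not s)))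

      spanning-length : ∀ {c j js} → Branch c j js → (∀ l → l ∈ˡ js) → length js ≡ n
      spanning-length branch all = unique-complete⇒length (branch-unique branch) all

      small-maximal-matching : (scheme : Scheme k) → Fin n →
        ∃[ M ] IsMaximalMatching G M × length M ≡ Scheme.size scheme true n
      small-maximal-matching scheme j₀ =
        let c , j , js , branch , all = spanning-branch j₀
            -- The branch contains all blocks, so nothing outside could cover `c`: hence `true`.
            open BranchMatching (branch-matching scheme branch true)
        in M
         , dominating⇒maximal matching (λ ab →
             let l , a∈ , b∈ = edge-in-block ab
                 x , x∈ , d = dominating (all l) a∈ b∈ ab
             in x , x∈ , [ id , (λ x≡c → subst (Covers M) (sym x≡c) covers-c) ]′ d)
         , trans size≡ (cong (Scheme.size scheme true) (spanning-length branch all))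

      -- Lower bound: counting along the chain

      module _ (w : ℕ) (bound : LocalBound k w) {M} (edges : All (IsEdge G) M)
               (disjoint : AllPairs Disjoint M) (dominating : Dominating M) where

        count : List (Fin n) → ℕ
        count js = length (filter (inBlocks? js) M)

        Outside : List (Fin n) → Fin v → Set
        Outside js x = Any (λ e → x ∈ᵉ e × ¬ InBlocks js e) M

        outside? : ∀ js x → Dec (Outside js x)
        outside? js x = Any.any? (λ e → (x ∈ᵉ? e) ×-dec ¬? (inBlocks? js e)) M

        outside⇒other-block : ∀ {j x} → Outside [ j ] x → ∃[ l ] l ≢ j × x ∈ B l
        outside⇒other-block out with find out
        ... | e , e∈ , x∈e , ¬in with edge-in-block (proj₂ (All.lookup edges e∈))
        ... | l , a∈ , b∈ = l , (λ { refl → ¬in (here (a∈ , b∈)) }) , edgeIn-∈ (a∈ , b∈) x∈e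

        -- An edge of the block is met by `M` restricted to the block, or by an edge of another
        -- block, which reaches `B j` only at a link.
        block-count : ∀ {c c′ j} → c ∈ B j → c′ ∈ B j → c ≢ c′ →
          (∀ {l x} → l ≢ j → x ∈ B l → x ∈ B j → x ≡ c ⊎ x ≡ c′) →
          2 ≤ w * count [ j ] + (indicator (outside? [ j ] c) + indicator (outside? [ j ] c′))
        block-count {c} {c′} {j} c∈ c′∈ c≢c′ only =
          bound (block-induces j) c∈ c′∈ c≢c′ (outside? [ j ]) (filter (inBlocks? [ j ]) M)
            (All.filter⁺ (inBlocks? [ j ]) edges)
            (All.map Any.singleton⁻ (All.all-filter (inBlocks? [ j ]) M))
            (λ x∈j out → let l , l≢j , x∈l = outside⇒other-block out in only l≢j x∈l x∈j)
            covered
          where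
          covered : ∀ {a b} → a ∈ B j → b ∈ B j → Adj a b →
                    ∃[ x ] x ∈ᵉ (a , b) × (Covers (filter (inBlocks? [ j ]) M) x ⊎ Outside [ j ] x)
          covered a∈ b∈ ab with dominating ab
          ... | x , x∈ , cov with find cov
          ... | e , e∈ , x∈e with inBlocks? [ j ] e
          ... | yes i = x , x∈ , inj₁ (lose (∈-filter⁺ (inBlocks? [ j ]) e∈ i) x∈e)
          ... | no ¬i = x , x∈ , inj₂ (lose e∈ (x∈e , ¬i))

        -- The local bound 2 and the bound for the rest add up to one more than is claimed; the
        -- outside terms at `c′` account for at most that one.
        branch-count : ∀ {c j js} → Branch c j js → suc (length js) ≤ w * count js + indicator (outside? js c)
        branch-count {c} {j} (leaf c∈ only)
          with another-vertex G 3≤k (block-induces j) c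
        ... | c′ , c′∈ , c′≢c = ℕ.≤-trans
          (block-count c∈ c′∈ (≢-sym c′≢c) (λ l≢j x∈l x∈j → inj₁ (only l≢j x∈l x∈j)))
          (ℕ.≤-reflexive (cong (w * count [ j ] +_)
            (trans (cong (indicator (outside? [ j ] c) +_) (indicator-no (outside? [ j ] c′) c′-inside))
                   (ℕ.+-identityʳ _))))
          where
          c′-inside : ¬ Outside [ j ] c′
          c′-inside out = let l , l≢j , c′∈l = outside⇒other-block out in c′≢c (only l≢j c′∈l c′∈)
        branch-count {c} {j} {js = _ ∷ js} (node {c′ = c′} {j′} c∈ c′∈ c≢c′ only blocks-c′ fresh branch) =
          combine (block-count c∈ c′∈ c≢c′ only) (branch-count branch)
            (indicator-exclusive (outside? [ j ] c′) (outside? js c′) exclusive)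
            (length-filter-disjoint (inBlocks? [ j ]) (inBlocks? js) (inBlocks? (j ∷ js))
              (All.map no-overlap edges) (λ i → here (Any.singleton⁻ i)) there)
            (indicator-mono (outside? [ j ] c) (outside? (j ∷ js) c) (Any.map still-outside))
          where
          -- At most one edge of `M` is at `c′`, and it lies in `j` or in `j′`, the head of the
          -- rest; so it cannot be outside both parts.
          exclusive : Outside [ j ] c′ → ¬ Outside js c′
          exclusive out out′ with find out | find out′
          ... | e , e∈ , x∈e , ¬in | f , f∈ , x∈f , ¬in′ with disjoint-shared disjoint e∈ f∈ x∈e x∈f
          ... | refl with edge-in-block (proj₂ (All.lookup edges e∈))
          ... | l , a∈ , b∈ with blocks-c′ l (edgeIn-∈ (a∈ , b∈) x∈e)
          ... | inj₁ refl = ¬in (here (a∈ , b∈))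
          ... | inj₂ refl = ¬in′ (lose (branch-head branch) (a∈ , b∈))
          no-overlap : ∀ {e} → IsEdge G e → InBlocks [ j ] e → ¬ InBlocks js e
          no-overlap edge (here (a∈ , b∈)) i =
            let l , l∈ , a∈l , b∈l = find i
            in isEdge⇒≢ edge (trans (fresh l∈ a∈l a∈) (sym (fresh l∈ b∈l b∈)))
          -- No later block contains `c`, so none contains an edge at `c`.
          still-outside : ∀ {e} → c ∈ᵉ e × ¬ InBlocks [ j ] e → c ∈ᵉ e × ¬ InBlocks (j ∷ js) e
          still-outside (c∈e , ¬in) = c∈e , λ where
            (here i)  → ¬in (here i)
            (there i) → let l , l∈ , c∈l = inBlocks-∈ i c∈e in c≢c′ (fresh l∈ c∈l c∈)
          combine : ∀ {m A A′ A″ x x′ y z} → 2 ≤ w * A + (x + y) → suc m ≤ w * A′ + z → y + z ≤ 1 →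
                    A + A′ ≤ A″ → x ≤ x′ → suc (suc m) ≤ w * A″ + x′
          combine {m} {A} {A′} {A″} {x} {x′} {y} {z} p q r u s = ℕ.+-cancelʳ-≤ 1 _ _ (begin
            suc (suc m) + 1                 ≡⟨ ℕ.+-comm _ 1 ⟩
            2 + suc m                       ≤⟨ ℕ.+-mono-≤ p q ⟩
            w * A + (x + y) + (w * A′ + z)  ≡⟨ solve 5 (λ a b x y z → a :+ (x :+ y) :+ (b :+ z) := a :+ b :+ x :+ (y :+ z)) refl (w * A) (w * A′) x y z ⟩
            w * A + w * A′ + x + (y + z)    ≡⟨ cong (λ h → h + x + (y + z)) (ℕ.*-distribˡ-+ w A A′) ⟨
            w * (A + A′) + x + (y + z)      ≤⟨ ℕ.+-mono-≤ (ℕ.+-mono-≤ (ℕ.*-monoʳ-≤ w u) s) r ⟩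
            w * A″ + x′ + 1                 ∎)
            where
            open ℕ.≤-Reasoning
            open +-*-Solver

        -- No edge is outside the spanning branch, so the correction at `c` vanishes.
        matching-bound : Fin n → suc n ≤ w * length M
        matching-bound j₀ with spanning-branch j₀
        ... | c , j , js , branch , all = begin
          suc n                                            ≡⟨ cong suc (spanning-length branch all) ⟨
          suc (length js)                                  ≤⟨ branch-count branch ⟩
          w * count js + indicator (outside? js c)         ≡⟨ cong (w * count js +_) (indicator-no (outside? js c) nothing-outside) ⟩
          w * count js + 0                                 ≡⟨ ℕ.+-identityʳ _ ⟩
          w * count js                                     ≤⟨ ℕ.*-monoʳ-≤ w (length-filter (inBlocks? js) M) ⟩
          w * length M                                     ∎
          where
          open ℕ.≤-Reasoning
          nothing-outside : ¬ Outside js c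
          nothing-outside out =
            let e , e∈ , _ , ¬in = find out
                l , a∈ , b∈ = edge-in-block (proj₂ (All.lookup edges e∈))
            in ¬in (lose (all l) (a∈ , b∈))

  -- Matchings of the model cycles, checked exhaustively

  CyclicAdj : ∀ {k} → Fin k → Fin k → Set
  CyclicAdj i j = Next i j ⊎ Next j i

  next? : ∀ {k} (i j : Fin k) → Dec (Next i j)
  next? {k} i j = (toℕ j ℕ.≟ suc (toℕ i)) ⊎-dec ((suc (toℕ i) ℕ.≟ k) ×-dec (toℕ j ℕ.≟ 0))

  cyclicAdj? : ∀ {k} (i j : Fin k) → Dec (CyclicAdj i j)
  cyclicAdj? i j = next? i j ⊎-dec next? j i

  -- Counterpart of `LocalMatching` on `Fin k`. It is decidable, so the tables below follow by
  -- evaluation over all positions of the two links.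
  CycleMatching : ∀ {k} → Fin k → Fin k → Bool → Bool → List (Fin k × Fin k) → Set
  CycleMatching i i′ t s P =
    All (λ (a , b) → CyclicAdj a b) P × AllPairs Disjoint P ×
    Status t (Covers P i) × Status s (Covers P i′) ×
    (∀ a b → CyclicAdj a b → Dominated a ⊎ Dominated b)
    where
    Dominated : Fin _ → Set
    Dominated x = Covers P x ⊎ x ≡ i ⊎ x ≡ i′

  cycleMatching? : ∀ {k} i i′ t s (P : List (Fin k × Fin k)) → Dec (CycleMatching i i′ t s P)
  cycleMatching? i i′ t s P =
    All.all? (λ (a , b) → cyclicAdj? a b) P ×-dec allPairs? disjoint? P ×-dec
    status? t (covers? P i) ×-dec status? s (covers? P i′) ×-dec
    all? λ a → all? λ b → cyclicAdj? a b →-dec (dominated? a ⊎-dec dominated? b)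
    where
    dominated? : ∀ x → Dec (Covers P x ⊎ x ≡ i ⊎ x ≡ i′)
    dominated? x = covers? P x ⊎-dec (x ≟ i) ⊎-dec (x ≟ i′)

  triangle-tt : ∀ (i i′ : Fin 3) → i ≢ i′ → CycleMatching i i′ true true [ (i , i′) ]
  triangle-tt = toWitness {a? = all? λ i → all? λ i′ → ¬? (i ≟ i′) →-dec cycleMatching? i i′ true true _} _

  -- Besides the excused `i` and `i′` only one vertex is left, so no edge escapes them.
  triangle-ff : ∀ (i i′ : Fin 3) → i ≢ i′ → CycleMatching i i′ false false []
  triangle-ff = toWitness {a? = all? λ i → all? λ i′ → ¬? (i ≟ i′) →-dec cycleMatching? i i′ false false _} _

  triangle-ft : ∀ (i i′ : Fin 3) → i ≢ i′ → ∃[ q ] CycleMatching i i′ false true [ (i′ , q) ]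
  triangle-ft = toWitness {a? = all? λ i → all? λ i′ → ¬? (i ≟ i′) →-dec any? λ q → cycleMatching? i i′ false true _} _

  square-tt : ∀ (i i′ : Fin 4) → i ≢ i′ → ∃[ p ] ∃[ q ] ∃[ r ] CycleMatching i i′ true true ((i , p) ∷ (q , r) ∷ [])
  square-tt = toWitness {a? = all? λ i → all? λ i′ → ¬? (i ≟ i′) →-dec any? λ p → any? λ q → any? λ r → cycleMatching? i i′ true true _} _

  -- An edge at `i′` that avoids `i` leaves a single vertex besides `i`, so every edge is met or
  -- excused.
  square-ft : ∀ (i i′ : Fin 4) → i ≢ i′ → ∃[ q ] CycleMatching i i′ false true [ (i′ , q) ]
  square-ft = toWitness {a? = all? λ i → all? λ i′ → ¬? (i ≟ i′) →-dec any? λ q → cycleMatching? i i′ false true _} _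

  EdgeAvoidingVertex : ℕ → Set
  EdgeAvoidingVertex k = ∀ (i : Fin k) → ∃[ a ] ∃[ b ] CyclicAdj a b × i ≢ a × i ≢ b

  edgeAvoidingVertex? : ∀ k → Dec (EdgeAvoidingVertex k)
  edgeAvoidingVertex? k = all? λ i → any? λ a → any? λ b → cyclicAdj? a b ×-dec ¬? (i ≟ a) ×-dec ¬? (i ≟ b)

  square-opposite : ∀ (i j : Fin 4) → CyclicAdj i j → ∃[ a ] ∃[ b ] CyclicAdj a b × Disjoint (i , j) (a , b)
  square-opposite = toWitness {a? = all? λ i → all? λ j → cyclicAdj? i j →-dec any? λ a → any? λ b → cyclicAdj? a b ×-dec disjoint? (i , j) (a , b)} _

  -- Transport of the tables into the graph

  module _ {v : ℕ} (G : Graph v) where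
    open Graph G using (Adj; irrefl) renaming (sym to adj-sym)

    module _ {k : ℕ} {S : Subset v} (S-cycle : InducesCycle G k S) where
      private
        f = proj₁ S-cycle
        f-injective = proj₁ (proj₂ S-cycle)
        S⇔ = proj₁ (proj₂ (proj₂ S-cycle))
        adj⇔ = proj₂ (proj₂ (proj₂ S-cycle))

        image : Fin k × Fin k → Fin v × Fin v
        image (a , b) = orient (f a , f b)

        image⁺ : ∀ {x} e → x ∈ᵉ e → f x ∈ᵉ image e
        image⁺ (a , b) (inj₁ refl) = ∈ᵉ-orient⁺ (f a , f b) (inj₁ refl)
        image⁺ (a , b) (inj₂ refl) = ∈ᵉ-orient⁺ (f a , f b) (inj₂ refl)

        image⁻ : ∀ {y} e → y ∈ᵉ image e → ∃[ x ] x ∈ᵉ e × y ≡ f x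
        image⁻ (a , b) y∈ with ∈ᵉ-orient⁻ (f a , f b) y∈
        ... | inj₁ refl = a , inj₁ refl , refl
        ... | inj₂ refl = b , inj₂ refl , refl

        image-∈ : ∀ {x} e → f x ∈ᵉ image e → x ∈ᵉ e
        image-∈ e fx∈ with image⁻ e fx∈
        ... | _ , x′∈ , eq = subst (_∈ᵉ e) (sym (f-injective eq)) x′∈

        f∈S : ∀ i → f i ∈ S
        f∈S i = from (S⇔ _) (i , refl)

        image-inside : ∀ e → EdgeIn G S (image e)
        image-inside e = inS (inj₁ refl) , inS (inj₂ refl)
          where
          inS : ∀ {y} → y ∈ᵉ image e → y ∈ S
          inS y∈ with image⁻ e y∈
          ... | x , _ , refl = f∈S x

        covers-image : ∀ {P x} → Covers P x → Covers (map image P) (f x)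
        covers-image = Any.map⁺ ∘ Any.map (λ {e} → image⁺ e)

        covers-image⁻ : ∀ {P x} → Covers (map image P) (f x) → Covers P x
        covers-image⁻ = Any.map (λ {e} → image-∈ e) ∘ Any.map⁻

        status-image : ∀ t {P x} → Status t (Covers P x) → Status t (Covers (map image P) (f x))
        status-image true  = covers-image
        status-image false ¬covered = ¬covered ∘ covers-image⁻

      transport : ∀ {i i′ t s P} → CycleMatching i i′ t s P → LocalMatching G S (f i) (f i′) t s (length P)
      transport {i} {i′} {t} {s} {P} (edges , disjoint , i-status , i′-status , dominating) = record
        { M = map image P
        ; matching = All.map⁺ (All.map (λ ab → orient-isEdge G (from (adj⇔ _ _) ab)) edges)
                   , AllPairs.map⁺ (AllPairs.map (λ {e} {e′} d → disjoint⁺ (no-common e e′ d)) disjoint)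
        ; inside = All.map⁺ (All.universal image-inside P)
        ; covers-c = status-image t i-status
        ; covers-c′ = status-image s i′-status
        ; dominating = dominating-image
        ; size≡ = length-map image P }
        where
        no-common : ∀ e e′ → Disjoint e e′ → ∀ {y} → y ∈ᵉ image e → ¬ (y ∈ᵉ image e′)
        no-common e e′ d y∈ y∈′ with image⁻ e y∈
        ... | x , x∈ , refl = disjoint⁻ d x∈ (image-∈ e′ y∈′)
        dominated : ∀ {x} → Covers P x ⊎ x ≡ i ⊎ x ≡ i′ → Covers (map image P) (f x) ⊎ f x ≡ f i ⊎ f x ≡ f i′
        dominated (inj₁ covered)     = inj₁ (covers-image covered)
        dominated (inj₂ (inj₁ refl)) = inj₂ (inj₁ refl)
        dominated (inj₂ (inj₂ refl)) = inj₂ (inj₂ refl)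
        dominating-image : ∀ {a b} → a ∈ S → b ∈ S → Adj a b →
          ∃[ x ] x ∈ᵉ (a , b) × (Covers (map image P) x ⊎ x ≡ f i ⊎ x ≡ f i′)
        dominating-image a∈ b∈ ab with to (S⇔ _) a∈ | to (S⇔ _) b∈
        ... | a , refl | b , refl with dominating a b (to (adj⇔ a b) ab)
        ... | inj₁ d = f a , inj₁ refl , dominated d
        ... | inj₂ d = f b , inj₂ refl , dominated d

      localMatching : ∀ {t s p} → (∀ i i′ → i ≢ i′ → ∃[ P ] CycleMatching i i′ t s P × length P ≡ p) →
                      ∀ {c c′} → c ∈ S → c′ ∈ S → c ≢ c′ → LocalMatching G S c c′ t s p
      localMatching table c∈ c′∈ c≢c′ with to (S⇔ _) c∈ | to (S⇔ _) c′∈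
      ... | i , refl | i′ , refl with table i i′ (c≢c′ ∘ cong f)
      ... | P , good , refl = transport good

      avoiding-edge : EdgeAvoidingVertex k → ∀ {c} → c ∈ S →
                      ∃[ a ] ∃[ b ] a ∈ S × b ∈ S × Adj a b × ¬ (c ∈ᵉ (a , b))
      avoiding-edge table c∈ with to (S⇔ _) c∈
      ... | i , refl with table i
      ... | a , b , ab , i≢a , i≢b =
        f a , f b , f∈S a , f∈S b , from (adj⇔ a b) ab , [ i≢a ∘ f-injective , i≢b ∘ f-injective ]′

      -- Some edge of the cycle misses `c′`; as only `c` and `c′` can satisfy `E`, it is met at `c`.
      -- The same holds with the two exchanged.
      covered-by-ends : EdgeAvoidingVertex k → ∀ {c c′} → c ∈ S → c′ ∈ S → ∀ {E : Fin v → Set} →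
        (∀ {x} → x ∈ S → E x → x ≡ c ⊎ x ≡ c′) →
        (∀ {a b} → a ∈ S → b ∈ S → Adj a b → ∃[ x ] x ∈ᵉ (a , b) × E x) → E c × E c′
      covered-by-ends table c∈ c′∈ {E} only covered =
        covers-end c′∈ only , covers-end c∈ (λ x∈ e → swap (only x∈ e))
        where
        covers-end : ∀ {d d′} → d′ ∈ S → (∀ {x} → x ∈ S → E x → x ≡ d ⊎ x ≡ d′) → E d
        covers-end d′∈ only with avoiding-edge table d′∈
        ... | a , b , a∈ , b∈ , ab , d′∉ with covered a∈ b∈ ab
        ... | x , x∈ , e with only (edgeIn-∈ G (a∈ , b∈) x∈) e
        ... | inj₁ refl = e
        ... | inj₂ refl = contradiction x∈ d′∉

    opposite-edge : ∀ {S} → InducesCycle G 4 S → ∀ {a b} → a ∈ S → b ∈ S → Adj a b →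
                    ∃[ c ] ∃[ d ] c ∈ S × d ∈ S × Adj c d × Disjoint (a , b) (c , d)
    opposite-edge (f , f-injective , S⇔ , adj⇔) a∈ b∈ ab with to (S⇔ _) a∈ | to (S⇔ _) b∈
    ... | i , refl | j , refl with square-opposite i j (to (adj⇔ i j) ab)
    ... | a , b , a~b , ia , ib , ja , jb =
      f a , f b , from (S⇔ _) (a , refl) , from (S⇔ _) (b , refl) , from (adj⇔ a b) a~b ,
      ia ∘ f-injective , ib ∘ f-injective , ja ∘ f-injective , jb ∘ f-injective

    -- Matching sizes for triangles and squares

    triangle-scheme : Scheme G 3
    triangle-scheme = record { size = size ; last = last ; more = more }
      where
      size : Bool → ℕ → ℕ
      size true  m = ⌊ 2 + m /2⌋
      size false m = ⌊ 1 + m /2⌋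
      table-tt : ∀ (i i′ : Fin 3) → i ≢ i′ → ∃[ P ] CycleMatching i i′ true true P × length P ≡ 1
      table-tt i i′ i≢i′ = _ , triangle-tt i i′ i≢i′ , refl
      last : ∀ {S c c′} → InducesCycle G 3 S → c ∈ S → c′ ∈ S → c ≢ c′ →
             ∀ t → LocalMatching G S c c′ t true (size t 1)
      last cyc c∈ c′∈ c≢c′ true  = localMatching cyc table-tt c∈ c′∈ c≢c′
      last cyc c∈ c′∈ c≢c′ false =
        localMatching cyc (λ i i′ i≢i′ → _ , proj₂ (triangle-ft i i′ i≢i′) , refl) c∈ c′∈ c≢c′
      more : ∀ {S c c′} → InducesCycle G 3 S → c ∈ S → c′ ∈ S → c ≢ c′ →
             ∀ t m → ∃[ s ] ∃[ p ] LocalMatching G S c c′ t s p × p + size (not s) m ≡ size t (suc m)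
      -- The edge between the links lets the rest avoid `c′`: 1 + ⌊(1 + m)/2⌋ = ⌊(3 + m)/2⌋.
      more cyc c∈ c′∈ c≢c′ true m = true , 1 , localMatching cyc table-tt c∈ c′∈ c≢c′ , refl
      -- No edge is spent here; the rest covers `c′` with ⌊(2 + m)/2⌋ edges.
      more cyc c∈ c′∈ c≢c′ false m =
        false , 0 , localMatching cyc (λ i i′ i≢i′ → _ , triangle-ff i i′ i≢i′ , refl) c∈ c′∈ c≢c′ , refl

    square-scheme : Scheme G 4
    square-scheme = record
      { size = size
      ; last = λ cyc c∈ c′∈ c≢c′ → local cyc c∈ c′∈ c≢c′
      -- A square always covers its next link itself, so the rest gets by with `m` edges.
      ; more = λ where
          cyc c∈ c′∈ c≢c′ true  m → true , 2 , local cyc c∈ c′∈ c≢c′ true , refl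
          cyc c∈ c′∈ c≢c′ false m → true , 1 , local cyc c∈ c′∈ c≢c′ false , refl }
      where
      size : Bool → ℕ → ℕ
      size true  m = suc m
      size false m = m
      local : ∀ {S c c′} → InducesCycle G 4 S → c ∈ S → c′ ∈ S → c ≢ c′ →
              ∀ t → LocalMatching G S c c′ t true (size t 1)
      local cyc c∈ c′∈ c≢c′ true  =
        localMatching cyc (λ i i′ i≢i′ → _ , proj₂ (proj₂ (proj₂ (square-tt i i′ i≢i′))) , refl) c∈ c′∈ c≢c′
      local cyc c∈ c′∈ c≢c′ false =
        localMatching cyc (λ i i′ i≢i′ → _ , proj₂ (square-ft i i′ i≢i′) , refl) c∈ c′∈ c≢c′

    -- Local bounds for triangles and squares

    uncovered-bound : ∀ {k} → EdgeAvoidingVertex k →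
      ∀ {S c c′} → InducesCycle G k S → c ∈ S → c′ ∈ S →
      ∀ {E : Fin v → Set} (E? : Decidable E) →
      (∀ {x} → x ∈ S → E x → x ≡ c ⊎ x ≡ c′) →
      (∀ {a b} → a ∈ S → b ∈ S → Adj a b → ∃[ x ] x ∈ᵉ (a , b) × (Covers [] x ⊎ E x)) →
      2 ≤ indicator (E? c) + indicator (E? c′)
    uncovered-bound table {c = c} {c′} cyc c∈ c′∈ E? only covered =
      let Ec , Ec′ = covered-by-ends cyc table c∈ c′∈ only
                       (λ a∈ b∈ ab → let x , x∈ , cov = covered a∈ b∈ ab in x , x∈ , [ (λ ()) , id ]′ cov)
      in ℕ.+-mono-≤ (indicator-yes (E? c) Ec) (indicator-yes (E? c′) Ec′)

    -- With weight 2 one edge suffices; with none, both links must be covered from outside.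
    triangle-bound : LocalBound G 3 2
    triangle-bound cyc c∈ c′∈ c≢c′ E? [] _ _ only covered =
      uncovered-bound (toWitness {a? = edgeAvoidingVertex? 3} _) cyc c∈ c′∈ E? only covered
    triangle-bound cyc c∈ c′∈ c≢c′ E? (_ ∷ L) _ _ _ _ =
      ℕ.≤-trans (ℕ.*-monoʳ-≤ 2 (s≤s (z≤n {length L}))) (ℕ.m≤m+n _ _)

    -- If the square has a single matching edge, the opposite edge can only be met from outside, at
    -- `c` or `c′`, which gives the missing unit.
    square-bound : LocalBound G 4 1
    square-bound cyc c∈ c′∈ c≢c′ E? [] _ _ only covered =
      uncovered-bound (toWitness {a? = edgeAvoidingVertex? 4} _) cyc c∈ c′∈ E? only covered
    square-bound {c = c} {c′} cyc c∈ c′∈ c≢c′ E? (e ∷ []) ((_ , ab) ∷ []) ((a∈ , b∈) ∷ []) only covered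
      with opposite-edge cyc a∈ b∈ ab
    ... | p , q , p∈ , q∈ , pq , disjoint with covered p∈ q∈ pq
    ... | x , x∈ , inj₁ (here x∈e) = contradiction x∈ (disjoint⁻ disjoint x∈e)
    ... | x , x∈ , inj₂ Ex with only (edgeIn-∈ G (p∈ , q∈) x∈) Ex
    ... | inj₁ refl = s≤s (ℕ.≤-trans (indicator-yes (E? c) Ex) (ℕ.m≤m+n _ _))
    ... | inj₂ refl = s≤s (ℕ.≤-trans (indicator-yes (E? c′) Ex) (ℕ.m≤n+m _ _))
    square-bound cyc c∈ c′∈ c≢c′ E? (_ ∷ _ ∷ L) _ _ _ _ = s≤s (s≤s z≤n)

    -- Saturation numbers and the closed formula

    saturation-lower : ∀ {k n} w (3≤k : 3 ≤ k) → IsChainCactus G k n → LocalBound G k w → Fin n →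
                       ∀ {M} → IsMaximalMatching G M → suc n ≤ w * length M
    saturation-lower w 3≤k chain bound j₀ maximal@((edges , disjoint) , _) =
      matching-bound G 3≤k chain w bound edges disjoint (maximal⇒dominating G maximal) j₀

    triangular-saturation : ∀ {n} → IsChainTriangularCactus G n → Fin n → IsSaturationNumber G ⌊ 2 + n /2⌋
    triangular-saturation {n} chain j₀ =
      small-maximal-matching G 3≤3 chain triangle-scheme j₀ , λ M maximal → begin
        -- This is `⌊ 2 + n /2⌋` by definition: halving n + 1 ≤ 2|M| and rounding up gives the
        -- claimed value.
        ⌈ suc n /2⌉                  ≤⟨ ℕ.⌈n/2⌉-mono (saturation-lower 2 3≤3 chain triangle-bound j₀ maximal) ⟩
        ⌈ 2 * length M /2⌉           ≡⟨ cong (λ m → ⌈ length M + m /2⌉) (ℕ.+-identityʳ (length M)) ⟩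
        ⌈ length M + length M /2⌉    ≡⟨ ℕ.n≡⌈n+n/2⌉ (length M) ⟨
        length M                     ∎
      where
      open ℕ.≤-Reasoning
      3≤3 : 3 ≤ 3
      3≤3 = ℕ.≤-refl

    square-saturation : ∀ {n} → IsChainSquareCactus G n → Fin n → IsSaturationNumber G (suc n)
    square-saturation chain j₀ =
      small-maximal-matching G 3≤4 chain square-scheme j₀ , λ M maximal →
        ℕ.≤-trans (saturation-lower 1 3≤4 chain square-bound j₀ maximal) (ℕ.≤-reflexive (ℕ.*-identityˡ _))
      where
      3≤4 : 3 ≤ 4
      3≤4 = ℕ.n≤1+n 3


open import Data.Integer using (+_; _+_; _-_; _/ℕ_)

n/2≡⌊n/2⌋ : ∀ n → n / 2 ≡ ⌊ n /2⌋
n/2≡⌊n/2⌋ zero = refl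
n/2≡⌊n/2⌋ (suc zero) = refl
n/2≡⌊n/2⌋ (suc (suc n)) = trans (ℕ.m/n≡1+[m∸n]/n {suc (suc n)} (s≤s (s≤s z≤n))) (cong suc (n/2≡⌊n/2⌋ n))

triangular-formula : ∀ n → n ≥ 1 → + ⌊ suc (suc n) /2⌋ ≡ (+ n - + 2) /ℕ 2 + + 2
-- Here the numerator is negative, and `/ℕ` rounds -1/2 down to -1.
triangular-formula 1 _ = refl
triangular-formula (suc (suc m)) _ = cong +_ (trans (cong (λ h → suc (suc h)) (sym (n/2≡⌊n/2⌋ m))) (ℕ.+-comm 2 (m / 2)))

theorem3p3 : (∀ (n : ℕ) → n ≥ 1 → ∀ {v : ℕ} (T : Graph v) → IsChainTriangularCactus T n →
    ∃[ s ] (IsSaturationNumber T s × + s ≡ (+ n - + 2) /ℕ 2 + + 2))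
    ×
    (∀ (n : ℕ) → n ≥ 1 → ∀ {v : ℕ} (O : Graph v) → IsChainSquareCactus O n →
    IsSaturationNumber O (suc n))
theorem3p3 =
  (λ n n≥1 T chain → ⌊ suc (suc n) /2⌋ , Saturation.triangular-saturation T chain (fromℕ< n≥1) , triangular-formula n n≥1) ,
  (λ n n≥1 O chain → Saturation.square-saturation O chain (fromℕ< n≥1))
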